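{- There are bounded functions $e_5, e_7, e_{11}$ on the positive integers such that for all positive integers $n$, $M(5, n) = \lfloor n/5\rfloor + e_5(n)$, $M(7, n) = \lfloor n/7\rfloor + e_7(n)$, and $M(11, n) = \lfloor n/35\rfloor + e_{11}(n)$.
   Context: The $T$-tetromino is the polyomino formed by four unit squares: three in a row together with a fourth square attached to the middle square of that row. A tiling of an $m\times n$ rectangle (of unit cells) by $T$-tetrominos and monominos is a partition of its cells into copies of the $T$-tetromino (in any rotation or reflection, aligned with the grid) and single cells (monominos). The gap number $M(m,n)$ is the least number of monominos occurring in such a tiling of the $m\times n$ rectangle. -}

module Defs where

open import Data.Nat using (ℕ; zero; suc; _+_; _≤_; _<_; _≡ᵇ_; NonZero)
open import Data.Nat.DivMod using (_/_)
open import Data.Bool using (Bool; true; false; _∧_)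
open import Data.List using (List; []; _∷_; _++_; concatMap; length; filter)
open import Data.Product using (_×_; _,_; Σ; Σ-syntax)
open import Data.Integer using (ℤ; +_; ∣_∣)
  renaming (_+_ to _+ℤ_)
open import Relation.Binary.PropositionalEquality using (_≡_)

-- A cell of the grid: (row , column), 0-based.
Cell : Set
Cell = ℕ × ℕ

-- A piece of a tiling.  A T-tetromino is described by the top-left corner
-- (i , j) of its bounding box together with one of its 4 orientations
-- (these are all rotations/reflections of the T-tetromino).
data Orient : Set where
  stemDown stemUp stemRight stemLeft : Orient

data Piece : Set where
  mono : ℕ → ℕ → Piece
  tee  : ℕ → ℕ → Orient → Piece

cells : Piece → List Cell
cells (mono i j) = (i , j) ∷ []
cells (tee i j stemDown)  = (i , j) ∷ (i , suc j) ∷ (i , suc (suc j)) ∷ (suc i , suc j) ∷ []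
cells (tee i j stemUp)    = (suc i , j) ∷ (suc i , suc j) ∷ (suc i , suc (suc j)) ∷ (i , suc j) ∷ []
cells (tee i j stemRight) = (i , j) ∷ (suc i , j) ∷ (suc (suc i) , j) ∷ (suc i , suc j) ∷ []
cells (tee i j stemLeft)  = (i , suc j) ∷ (suc i , suc j) ∷ (suc (suc i) , suc j) ∷ (suc i , j) ∷ []

occ : Cell → List Cell → ℕ
occ c [] = 0
occ (r , s) ((r' , s') ∷ cs) with (r ≡ᵇ r') ∧ (s ≡ᵇ s')
... | true  = suc (occ (r , s) cs)
... | false = occ (r , s) cs

InRect : ℕ → ℕ → Cell → Set
InRect m n (r , s) = (r < m) × (s < n)

data AllIn (m n : ℕ) : List Cell → Set where
  []  : AllIn m n []
  _∷_ : ∀ {c cs} → InRect m n c → AllIn m n cs → AllIn m n (c ∷ cs)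

Tiling : ℕ → ℕ → List Piece → Set
Tiling m n ps =
  AllIn m n (concatMap cells ps) ×
  (∀ r s → r < m → s < n → occ (r , s) (concatMap cells ps) ≡ 1)

monos : List Piece → ℕ
monos [] = 0
monos (mono _ _ ∷ ps) = suc (monos ps)
monos (tee _ _ _ ∷ ps) = monos ps

IsGapNumber : ℕ → ℕ → ℕ → Set
IsGapNumber m n k =
  (Σ[ ps ∈ List Piece ] (Tiling m n ps × monos ps ≡ k)) ×
  (∀ ps → Tiling m n ps → k ≤ monos ps)

BoundedPos : (ℕ → ℤ) → Set
BoundedPos e = Σ[ B ∈ ℕ ] (∀ n → 1 ≤ n → ∣ e n ∣ ≤ B)

GapFormula : (m d : ℕ) .{{_ : NonZero d}} → (ℕ → ℤ) → ℕ → Set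
GapFormula m d e n = Σ[ k ∈ ℕ ] (IsGapNumber m n k × (+ k ≡ (+ (n / d)) +ℤ e n))

{-# OPTIONS --safe #-}
-- Label every square of a tiling as a monomino, as the centre of a tetromino, or as a limb pointing
-- to its centre, and colour the edges between a limb and its centre.  A tiling of an m × n rectangle
-- then becomes a walk of length n on the words of length m over three colours (the vertical edges
-- between two consecutive columns).  For m = 5, 7, 11 and P = 5, 7, 35 there is a bounded potential
-- on these words which grows by one along each column and falls by at most P at each monomino;
-- so every tiling has at least n / P - O(1) monominoes.  The potential is given by its superlevel
-- sets, which are computed and checked by evaluation.  Conversely, repeating a block of width P c
-- with c monominoes, and filling the two ends with monominoes, uses at most n / P + O(1) of them.
module Submission where

open import Defs
open import Data.Bool using (Bool; true; false; _∧_; T)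
open import Data.Integer using (ℤ; _⊖_; ∣_∣) renaming (+_ to pos; _+_ to _+ℤ_)
open import Data.Integer.Properties using (∣⊖∣-≤; ∣m⊖n∣≡∣n⊖m∣; distribʳ-⊖-+-pos; ⊖-≥)
open import Data.List
  using (List; []; _∷_; _++_; concatMap; length; map; filter; upTo; cartesianProductWith; drop)
open import Data.List.Membership.Propositional using (_∈_; find; lose)
open import Data.List.Membership.Propositional.Properties
  using (∈-++⁺ˡ; ∈-++⁺ʳ; ∈-++⁻; ∈-concatMap⁺; ∈-concatMap⁻; ∈-map⁻; ∈-map⁺; ∈-cartesianProductWith⁺; ∈-upTo⁺)
open import Data.List.Properties using (concatMap-++; map-++; ++-assoc; map-∘; length-map; length-++)
open import Data.List.Relation.Unary.All using (All; []; _∷_; all?; lookup)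
open import Data.List.Relation.Unary.Any using (here; there; any?)
open import Data.Nat
  using (ℕ; zero; suc; _+_; _*_; _∸_; _≤_; _<_; z≤n; s≤s; _≡ᵇ_; _≤?_; _<?_; _≟_; NonZero)
open import Data.Nat.DivMod using (_/_; _%_; m≡m%n+[m/n]*n; m%n<n; m*n/n≡m; /-monoˡ-≤)
open import Data.Nat.ListAction using (sum)
open import Data.Nat.ListAction.Properties using (sum-++)
open import Data.Nat.Properties hiding (_≟_; _≤?_; _<?_)
open import Algebra.Properties.CommutativeSemigroup +-commutativeSemigroup using (x∙yz≈y∙xz)
open import Data.Product using (_×_; _,_; proj₁; proj₂; Σ-syntax; ∃; ∃₂)
open import Data.Product.Properties using () renaming (≡-dec to ×-≡-dec)
open import Data.Sum using (_⊎_; inj₁; inj₂)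
open import Data.Unit using (tt)
open import Data.Vec using (Vec; []; _∷_) renaming (map to mapᵛ)
open import Function using (_∘_; Injective)
open import Relation.Binary using (DecidableEquality)
open import Relation.Binary.PropositionalEquality
  using (_≡_; _≢_; refl; sym; trans; cong; cong₂; subst; module ≡-Reasoning)
open import Relation.Nullary using (¬_; Dec; yes; no; contradiction)
open import Relation.Nullary.Decidable using (_×-dec_; map′; toWitness)

-- Counting cells

_≟ᶜ_ : DecidableEquality Cell
_≟ᶜ_ = ×-≡-dec _≟_ _≟_

occ-here : ∀ c cs → occ c (c ∷ cs) ≡ suc (occ c cs)
occ-here (r , s) cs with (r ≡ᵇ r) ∧ (s ≡ᵇ s) | ≡ᵇ-∧ r s
  where
  ≡ᵇ-refl : ∀ n → (n ≡ᵇ n) ≡ true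
  ≡ᵇ-refl zero = refl
  ≡ᵇ-refl (suc n) = ≡ᵇ-refl n
  ≡ᵇ-∧ : ∀ r s → (r ≡ᵇ r) ∧ (s ≡ᵇ s) ≡ true
  ≡ᵇ-∧ r s rewrite ≡ᵇ-refl r = ≡ᵇ-refl s
... | true | _ = refl

occ-there : ∀ {c d} cs → c ≢ d → occ c (d ∷ cs) ≡ occ c cs
occ-there {r , s} {r′ , s′} cs c≢d with r ≡ᵇ r′ in r≡ | s ≡ᵇ s′ in s≡
... | false | _     = refl
... | true  | false = refl
... | true  | true  = contradiction
  (cong₂ _,_ (≡ᵇ⇒≡ r r′ (subst T (sym r≡) _)) (≡ᵇ⇒≡ s s′ (subst T (sym s≡) _))) c≢d

occ-++ : ∀ c xs ys → occ c (xs ++ ys) ≡ occ c xs + occ c ys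
occ-++ c [] ys = refl
occ-++ c (x ∷ xs) ys with c ≟ᶜ x
... | yes refl rewrite occ-here c (xs ++ ys) | occ-here c xs = cong suc (occ-++ c xs ys)
... | no c≢x rewrite occ-there (xs ++ ys) c≢x | occ-there xs c≢x = occ-++ c xs ys

occ-∷ : ∀ c d cs → occ c (d ∷ cs) ≡ occ c (d ∷ []) + occ c cs
occ-∷ c d = occ-++ c (d ∷ [])

∈⇒occ : ∀ {c cs} → c ∈ cs → 1 ≤ occ c cs
∈⇒occ {c} {_ ∷ cs} (here refl) rewrite occ-here c cs = s≤s z≤n
∈⇒occ {c} {d ∷ cs} (there c∈cs) rewrite occ-∷ c d cs =
  ≤-trans (∈⇒occ c∈cs) (m≤n+m _ (occ c (d ∷ [])))

occ⇒∈ : ∀ {c} cs → 1 ≤ occ c cs → c ∈ cs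
occ⇒∈ {c} (d ∷ cs) p with c ≟ᶜ d
... | yes refl = here refl
... | no c≢d = there (occ⇒∈ cs (subst (1 ≤_) (occ-there cs c≢d) p))

∉⇒occ : ∀ {c} cs → ¬ c ∈ cs → occ c cs ≡ 0
∉⇒occ {c} cs c∉cs with occ c cs in eq
... | zero = refl
... | suc _ = contradiction (occ⇒∈ cs (subst (1 ≤_) (sym eq) (s≤s z≤n))) c∉cs

occ-map : ∀ {f} → Injective _≡_ _≡_ f → ∀ c cs → occ (f c) (map f cs) ≡ occ c cs
occ-map f-inj c [] = refl
occ-map {f} f-inj c (d ∷ cs) with c ≟ᶜ d
... | yes refl rewrite occ-here (f c) (map f cs) | occ-here c cs = cong suc (occ-map f-inj c cs)
... | no c≢d rewrite occ-there (map f cs) (c≢d ∘ f-inj) | occ-there cs c≢d = occ-map f-inj c cs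

sum-zero : ∀ {A : Set} (xs : List A) → sum (map (λ _ → 0) xs) ≡ 0
sum-zero [] = refl
sum-zero (_ ∷ xs) = sum-zero xs

sum-occ-∷ : ∀ y ys xs →
  sum (map (λ c → occ c (y ∷ ys)) xs) ≡ occ y xs + sum (map (λ c → occ c ys) xs)
sum-occ-∷ y ys [] = refl
sum-occ-∷ y ys (x ∷ xs) with x ≟ᶜ y | sum-occ-∷ y ys xs
... | yes refl | ih rewrite occ-here x ys | occ-here x xs | ih =
  cong suc (x∙yz≈y∙xz (occ x ys) (occ x xs) _)
... | no x≢y | ih rewrite occ-there ys x≢y | occ-there xs (x≢y ∘ sym) | ih =
  x∙yz≈y∙xz (occ x ys) (occ y xs) _

-- Double counting: exchanging the two sums, each entry of `ys` is counted once per occurrence in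
-- `xs`, so at most once. This compares sizes of cell lists without building injections.
sum-occ≤length : ∀ xs → (∀ c → occ c xs ≤ 1) → ∀ ys → sum (map (λ c → occ c ys) xs) ≤ length ys
sum-occ≤length xs occ≤1 [] = ≤-reflexive (sum-zero xs)
sum-occ≤length xs occ≤1 (y ∷ ys) rewrite sum-occ-∷ y ys xs =
  +-mono-≤ (occ≤1 y) (sum-occ≤length xs occ≤1 ys)

sum-map-mono : ∀ {A : Set} {f g : A → ℕ} xs → (∀ {x} → x ∈ xs → f x ≤ g x) →
  sum (map f xs) ≤ sum (map g xs)
sum-map-mono [] f≤g = z≤n
sum-map-mono (x ∷ xs) f≤g = +-mono-≤ (f≤g (here refl)) (sum-map-mono xs (f≤g ∘ there))

length≡sum : ∀ {A : Set} (xs : List A) → length xs ≡ sum (map (λ _ → 1) xs)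
length≡sum [] = refl
length≡sum (_ ∷ xs) = cong suc (length≡sum xs)

-- Rectangles listed column by column

down right : Cell → Cell
down (r , s) = suc r , s
right (r , s) = r , suc s

down-injective : Injective _≡_ _≡_ down
down-injective refl = refl

right-injective : Injective _≡_ _≡_ right
right-injective refl = refl

column : ℕ → List Cell
column zero = []
column (suc m) = (0 , 0) ∷ map down (column m)

-- Splitting off the first column leaves a translate of a narrower rectangle; both the walk along
-- the columns and the gluing of blocks recurse in this way.
rect : ℕ → ℕ → List Cell
rect m zero = []
rect m (suc n) = column m ++ map right (rect m n)

∈-column⁻ : ∀ m {c} → c ∈ column m → InRect m 1 c
∈-column⁻ (suc m) (here refl) = s≤s z≤n , s≤s z≤n
∈-column⁻ (suc m) (there c∈) with ∈-map⁻ down c∈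
... | _ , d∈ , refl with ∈-column⁻ m d∈
... | r< , s< = s≤s r< , s<

∈-rect⁻ : ∀ m n {c} → c ∈ rect m n → InRect m n c
∈-rect⁻ m (suc n) c∈ with ∈-++⁻ (column m) c∈
... | inj₁ c∈ˡ with ∈-column⁻ m c∈ˡ
...   | r< , s≤s z≤n = r< , s≤s z≤n
∈-rect⁻ m (suc n) c∈ | inj₂ c∈ʳ with ∈-map⁻ right c∈ʳ
... | _ , d∈ , refl with ∈-rect⁻ m n d∈
...   | r< , s< = r< , s≤s s<

occ-column : ∀ m {r} → r < m → occ (r , 0) (column m) ≡ 1
occ-column (suc m) {zero} _ = cong suc (∉⇒occ (map down (column m)) λ c∈ → 0∉ (∈-map⁻ down c∈))
  where
  0∉ : ¬ ∃ λ d → d ∈ column m × (0 , 0) ≡ down d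
  0∉ (_ , _ , ())
occ-column (suc m) {suc r} (s≤s r<m) = trans (occ-map down-injective (r , 0) (column m)) (occ-column m r<m)

occ-rect : ∀ m n {c} → InRect m n c → occ c (rect m n) ≡ 1
occ-rect m (suc n) {r , zero} (r< , _)
  rewrite occ-++ (r , 0) (column m) (map right (rect m n)) | occ-column m r<
  = cong suc (∉⇒occ (map right (rect m n)) λ c∈ → 0∉ (∈-map⁻ right c∈))
  where
  0∉ : ¬ ∃ λ d → d ∈ rect m n × (r , 0) ≡ right d
  0∉ (_ , _ , ())
occ-rect m (suc n) {r , suc s} (r< , s≤s s<)
  rewrite occ-++ (r , suc s) (column m) (map right (rect m n))
        | ∉⇒occ {r , suc s} (column m) (λ c∈ → ≤⇒≯ (s≤s z≤n) (proj₂ (∈-column⁻ m c∈)))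
  = trans (occ-map right-injective (r , s) (rect m n)) (occ-rect m n (r< , s<))

occ-rect≤1 : ∀ m n c → occ c (rect m n) ≤ 1
occ-rect≤1 m n c with 1 ≤? occ c (rect m n)
... | yes p = ≤-reflexive (occ-rect m n (∈-rect⁻ m n (occ⇒∈ (rect m n) p)))
... | no ¬p = <⇒≤ (≰⇒> ¬p)

-- Equality of cell lists as multisets

infix 4 _≈_
record _≈_ (xs ys : List Cell) : Set where
  constructor same
  field count : ∀ c → occ c xs ≡ occ c ys

open _≈_

≡⇒≈ : ∀ {xs ys} → xs ≡ ys → xs ≈ ys
≡⇒≈ refl = same λ _ → refl

≈-trans : ∀ {xs ys zs} → xs ≈ ys → ys ≈ zs → xs ≈ zs
≈-trans p q = same λ c → trans (count p c) (count q c)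

++-≈ : ∀ {xs ys xs′ ys′} → xs ≈ xs′ → ys ≈ ys′ → xs ++ ys ≈ xs′ ++ ys′
++-≈ {xs} {ys} {xs′} {ys′} p q = same λ c →
  trans (occ-++ c xs ys) (trans (cong₂ _+_ (count p c) (count q c)) (sym (occ-++ c xs′ ys′)))

++-comm : ∀ xs ys → xs ++ ys ≈ ys ++ xs
++-comm xs ys = same λ c →
  trans (occ-++ c xs ys) (trans (+-comm (occ c xs) (occ c ys)) (sym (occ-++ c ys xs)))

map-right-≈ : ∀ {xs ys} → xs ≈ ys → map right xs ≈ map right ys
map-right-≈ {xs} {ys} p = same λ where
    (r , zero) → trans (none r xs) (sym (none r ys))
    (r , suc s) → trans (occ-map right-injective (r , s) xs)
      (trans (count p (r , s)) (sym (occ-map right-injective (r , s) ys)))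
  where
  0∉ : ∀ r zs → ¬ ∃ λ d → d ∈ zs × (r , 0) ≡ right d
  0∉ _ _ (_ , _ , ())
  none : ∀ r zs → occ (r , 0) (map right zs) ≡ 0
  none r zs = ∉⇒occ (map right zs) λ c∈ → 0∉ r zs (∈-map⁻ right c∈)

-- A decidable form of `_≈_`: only cells occurring in one of the lists are compared, since any other
-- cell has count zero in both.
SameCounts : List Cell → List Cell → Set
SameCounts xs ys = All (λ c → occ c xs ≡ occ c ys) (xs ++ ys)

sameCounts? : ∀ xs ys → Dec (SameCounts xs ys)
sameCounts? xs ys = all? (λ c → occ c xs ≟ occ c ys) (xs ++ ys)

SameCounts⇒≈ : ∀ xs ys → SameCounts xs ys → xs ≈ ys
SameCounts⇒≈ xs ys agree = same equal
  where
  equal : ∀ c → occ c xs ≡ occ c ys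
  equal c with 1 ≤? occ c xs | 1 ≤? occ c ys
  ... | yes p | _ = lookup agree (∈-++⁺ˡ (occ⇒∈ xs p))
  ... | no _ | yes q = lookup agree (∈-++⁺ʳ xs (occ⇒∈ ys q))
  ... | no ¬p | no ¬q = trans (n<1⇒n≡0 (≰⇒> ¬p)) (sym (n<1⇒n≡0 (≰⇒> ¬q)))

AllIn⁺ : ∀ {m n} cs → (∀ {c} → c ∈ cs → InRect m n c) → AllIn m n cs
AllIn⁺ [] p = []
AllIn⁺ (c ∷ cs) p = p (here refl) ∷ AllIn⁺ cs (p ∘ there)

AllIn⁻ : ∀ {m n cs c} → AllIn m n cs → c ∈ cs → InRect m n c
AllIn⁻ (p ∷ _) (here refl) = p
AllIn⁻ (_ ∷ ps) (there c∈) = AllIn⁻ ps c∈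

≈rect⇒Tiling : ∀ {m n} ps → concatMap cells ps ≈ rect m n → Tiling m n ps
≈rect⇒Tiling {m} {n} ps p =
  AllIn⁺ _ (λ {c} c∈ → ∈-rect⁻ m n (occ⇒∈ (rect m n) (subst (1 ≤_) (count p c) (∈⇒occ c∈)))) ,
  λ r s r< s< → trans (count p (r , s)) (occ-rect m n (r< , s<))

Tiling⇒occ≤1 : ∀ {m n ps} → Tiling m n ps → ∀ c → occ c (concatMap cells ps) ≤ 1
Tiling⇒occ≤1 {ps = ps} (inside , once) c with 1 ≤? occ c (concatMap cells ps)
... | no ¬p = <⇒≤ (≰⇒> ¬p)
... | yes p with AllIn⁻ inside (occ⇒∈ (concatMap cells ps) p)
...   | r< , s< = ≤-reflexive (once _ _ r< s<)

-- Existence of the gap number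

AllIn? : ∀ m n cs → Dec (AllIn m n cs)
AllIn? m n [] = yes []
AllIn? m n ((r , s) ∷ cs) = map′ (λ (p , ps) → p ∷ ps) (λ { (p ∷ ps) → p , ps })
  (((r <? m) ×-dec (s <? n)) ×-dec AllIn? m n cs)

Tiling? : ∀ m n ps → Dec (Tiling m n ps)
Tiling? m n ps = AllIn? m n (concatMap cells ps) ×-dec
  map′ (λ f r s r< s< → f {r} r< {s} s<) (λ f {r} r< {s} s< → f r s r< s<)
    (allUpTo? (λ r → allUpTo? (λ s → occ (r , s) (concatMap cells ps) ≟ 1) n) m)

-- Recursion on the length bound: the empty list is tried first, then every head from `U` with the
-- predicate pulled back along consing that head.
boundedSearch : ∀ {A : Set} (U : List A) {Q : List A → Set} → (∀ xs → Dec (Q xs)) → ∀ L →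
  Dec (∃ λ xs → length xs ≤ L × All (_∈ U) xs × Q xs)
boundedSearch U {Q} Q? L with Q? []
... | yes q = yes ([] , z≤n , [] , q)
boundedSearch U {Q} Q? zero | no ¬q = no λ { ([] , _ , _ , q) → ¬q q }
boundedSearch U {Q} Q? (suc L) | no ¬q
  with any? (λ x → boundedSearch U (λ xs → Q? (x ∷ xs)) L) U
... | yes a with find a
...   | x , x∈U , xs , len , xs⊆U , q = yes (x ∷ xs , s≤s len , x∈U ∷ xs⊆U , q)
boundedSearch U {Q} Q? (suc L) | no ¬q | no ¬a = no λ
  { ([] , _ , _ , q) → ¬q q
  ; (x ∷ xs , s≤s len , x∈U ∷ xs⊆U , q) → ¬a (lose x∈U (xs , len , xs⊆U , q)) }

shapes : List (ℕ → ℕ → Piece)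
shapes = mono ∷ map (λ o i j → tee i j o) (stemDown ∷ stemUp ∷ stemRight ∷ stemLeft ∷ [])

place : (ℕ → ℕ → Piece) → Cell → Piece
place f (i , j) = f i j

-- A finite stock containing every piece that fits. Pieces that stick out of the rectangle are
-- included too; they are excluded later by `Tiling?`.
piecesIn : ℕ → ℕ → List Piece
piecesIn m n = cartesianProductWith place shapes (cartesianProductWith _,_ (upTo m) (upTo n))

∈-piecesIn⁺ : ∀ {m n i j} f → f ∈ shapes → i < m → j < n → f i j ∈ piecesIn m n
∈-piecesIn⁺ f f∈ i< j< =
  ∈-cartesianProductWith⁺ place f∈ (∈-cartesianProductWith⁺ _,_ (∈-upTo⁺ i<) (∈-upTo⁺ j<))

AllIn⇒∈piecesIn : ∀ {m n} p → AllIn m n (cells p) → p ∈ piecesIn m n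
AllIn⇒∈piecesIn (mono i j) ((i< , j<) ∷ _) = ∈-piecesIn⁺ mono (here refl) i< j<
AllIn⇒∈piecesIn (tee i j stemDown) ((i< , j<) ∷ _) =
  ∈-piecesIn⁺ (λ i j → tee i j stemDown) (there (here refl)) i< j<
AllIn⇒∈piecesIn (tee i j stemUp) ((i< , j<) ∷ _) =
  ∈-piecesIn⁺ (λ i j → tee i j stemUp) (there (there (here refl))) (<⇒≤ i<) j<
AllIn⇒∈piecesIn (tee i j stemRight) ((i< , j<) ∷ _) =
  ∈-piecesIn⁺ (λ i j → tee i j stemRight) (there (there (there (here refl)))) i< j<
AllIn⇒∈piecesIn (tee i j stemLeft) ((i< , j<) ∷ _) =
  ∈-piecesIn⁺ (λ i j → tee i j stemLeft) (there (there (there (there (here refl))))) i< (<⇒≤ j<)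

AllIn-concatMap⁻ : ∀ {m n} ps → AllIn m n (concatMap cells ps) → All (_∈ piecesIn m n) ps
AllIn-concatMap⁻ [] _ = []
AllIn-concatMap⁻ (p ∷ ps) a =
  AllIn⇒∈piecesIn p (AllIn⁺ (cells p) (AllIn⁻ a ∘ ∈-++⁺ˡ)) ∷
  AllIn-concatMap⁻ ps (AllIn⁺ (concatMap cells ps) (AllIn⁻ a ∘ ∈-++⁺ʳ (cells p)))

length≤length-cells : ∀ ps → length ps ≤ length (concatMap cells ps)
length≤length-cells [] = z≤n
length≤length-cells (p ∷ ps) rewrite length-++ (cells p) {concatMap cells ps} =
  +-mono-≤ (nonempty p) (length≤length-cells ps)
  where
  nonempty : ∀ p → 1 ≤ length (cells p)
  nonempty (mono _ _) = s≤s z≤n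
  nonempty (tee _ _ stemDown) = s≤s z≤n
  nonempty (tee _ _ stemUp) = s≤s z≤n
  nonempty (tee _ _ stemRight) = s≤s z≤n
  nonempty (tee _ _ stemLeft) = s≤s z≤n

-- Each piece has a cell and the cells are distinct cells of the rectangle, so the area bounds the
-- number of pieces. This makes the search for tilings finite.
Tiling⇒length≤ : ∀ {m n ps} → Tiling m n ps → length ps ≤ length (rect m n)
Tiling⇒length≤ {m} {n} {ps} t@(inside , _) = begin
  length ps                                   ≤⟨ length≤length-cells ps ⟩
  length cs                                   ≡⟨ length≡sum cs ⟩
  sum (map (λ _ → 1) cs)                      ≤⟨ sum-map-mono cs (λ c∈ → ≤-reflexive (sym (occ-rect m n (AllIn⁻ inside c∈)))) ⟩
  sum (map (λ c → occ c (rect m n)) cs)       ≤⟨ sum-occ≤length cs (Tiling⇒occ≤1 {ps = ps} t) (rect m n) ⟩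
  length (rect m n)                           ∎
  where
  open ≤-Reasoning
  cs = concatMap cells ps

least : ∀ {P : ℕ → Set} → (∀ k → Dec (P k)) → ∀ {k} → P k → ∃ λ l → P l × (∀ j → P j → l ≤ j)
least {P} P? {k} pk with P? 0
... | yes p0 = 0 , p0 , λ _ _ → z≤n
least {P} P? {zero} pk | no ¬p0 = contradiction pk ¬p0
least {P} P? {suc k} pk | no ¬p0 with least (P? ∘ suc) pk
... | l , pl , min = suc l , pl , λ { zero p0 → contradiction p0 ¬p0 ; (suc j) pj → s≤s (min j pj) }

tilingWith? : ∀ m n k → Dec (∃ λ ps → Tiling m n ps × monos ps ≡ k)
tilingWith? m n k = map′
  (λ (ps , _ , _ , t) → ps , t)
  (λ (ps , t , eq) → ps , Tiling⇒length≤ {ps = ps} t , AllIn-concatMap⁻ ps (proj₁ t) , t , eq)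
  (boundedSearch (piecesIn m n) (λ ps → Tiling? m n ps ×-dec (monos ps ≟ k)) (length (rect m n)))

-- Constructively, a least count requires that having a tiling with exactly `k` monominoes be
-- decidable; the exhaustive search provides this.
gapNumber : ∀ {m n ps} → Tiling m n ps → ∃ (IsGapNumber m n)
gapNumber {m} {n} {ps} t with least (tilingWith? m n) (ps , t , refl)
... | k , tk , min = k , tk , λ ps t → min (monos ps) (ps , t , refl)

-- Edge labelling

data Dir : Set where
  N E S W : Dir

-- limb d is a non-central square of a tetromino whose centre lies in direction d; hub d is a centre
-- whose neighbour in direction d does not belong to the tetromino.
data Label : Set where
  single : Label
  limb hub : Dir → Label

-- The edge of two adjacent squares is blank unless they are a limb and its hub; it is inward if the
-- limb comes first in reading order, and outward otherwise.
data Colour : Set where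
  blank inward outward : Colour

-- A limb colours only the edge towards its hub, and a hub the three edges towards its limbs.
-- Agreement of colours across common edges, with blank edges at the top and bottom, is all that the
-- lower bound retains besides the count of single squares.
west east north south : Label → Colour
west (limb W) = outward
west (hub N) = inward
west (hub E) = inward
west (hub S) = inward
west _ = blank
east (limb E) = inward
east (hub N) = outward
east (hub S) = outward
east (hub W) = outward
east _ = blank
north (limb N) = outward
north (hub E) = inward
north (hub S) = inward
north (hub W) = inward
north _ = blank
south (limb S) = inward
south (hub N) = outward
south (hub E) = outward
south (hub W) = outward
south _ = blank

labels : Piece → List (Cell × Label)
labels (mono i j) = ((i , j) , single) ∷ []
labels (tee i j stemDown) =
  ((i , j) , limb E) ∷ ((i , suc j) , hub N) ∷ ((i , suc (suc j)) , limb W) ∷ ((suc i , suc j) , limb N) ∷ []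
labels (tee i j stemUp) =
  ((suc i , j) , limb E) ∷ ((suc i , suc j) , hub S) ∷ ((suc i , suc (suc j)) , limb W) ∷ ((i , suc j) , limb S) ∷ []
labels (tee i j stemRight) =
  ((i , j) , limb S) ∷ ((suc i , j) , hub W) ∷ ((suc (suc i) , j) , limb N) ∷ ((suc i , suc j) , limb W) ∷ []
labels (tee i j stemLeft) =
  ((i , suc j) , limb S) ∷ ((suc i , suc j) , hub E) ∷ ((suc (suc i) , suc j) , limb N) ∷ ((suc i , j) , limb E) ∷ []

cells≡labels : ∀ p → cells p ≡ map proj₁ (labels p)
cells≡labels (mono _ _) = refl
cells≡labels (tee _ _ stemDown) = refl
cells≡labels (tee _ _ stemUp) = refl
cells≡labels (tee _ _ stemRight) = refl
cells≡labels (tee _ _ stemLeft) = refl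

allLabels : List Piece → List (Cell × Label)
allLabels = concatMap labels

cells≡allLabels : ∀ ps → concatMap cells ps ≡ map proj₁ (allLabels ps)
cells≡allLabels [] = refl
cells≡allLabels (p ∷ ps) rewrite map-++ proj₁ (labels p) (allLabels ps) =
  cong₂ _++_ (cells≡labels p) (cells≡allLabels ps)

Matched : (Cell → Cell → Set) → (Label → Colour) → (Label → Colour) →
  List (Cell × Label) → Cell × Label → Set
Matched _⇝_ side side′ L (c , l) =
  side l ≡ blank ⊎ ∃₂ λ c′ l′ → (c ⇝ c′) × (c′ , l′) ∈ L × side l ≡ side′ l′

-- Steps to the west and north are expressed as converses, because `right` and `down` have no total
-- inverses on natural coordinates.
_⟶_via_ _⟵_via_ : Cell → Cell → (Cell → Cell) → Set
c ⟶ d via f = d ≡ f c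
c ⟵ d via f = c ≡ f d

pattern 1st = here refl
pattern 2nd = there (here refl)
pattern 3rd = there (there (here refl))
pattern 4th = there (there (there (here refl)))
pattern partner k = inj₂ (_ , _ , refl , k , refl)
pattern none = inj₁ refl

eastward : ∀ p → All (Matched (_⟶_via right) east west (labels p)) (labels p)
eastward (mono _ _) = none ∷ []
eastward (tee _ _ stemDown) = partner 2nd ∷ partner 3rd ∷ none ∷ none ∷ []
eastward (tee _ _ stemUp) = partner 2nd ∷ partner 3rd ∷ none ∷ none ∷ []
eastward (tee _ _ stemRight) = none ∷ partner 4th ∷ none ∷ none ∷ []
eastward (tee _ _ stemLeft) = none ∷ none ∷ none ∷ partner 2nd ∷ []

westward : ∀ p → All (Matched (_⟵_via right) west east (labels p)) (labels p)
westward (mono _ _) = none ∷ []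
westward (tee _ _ stemDown) = none ∷ partner 1st ∷ partner 2nd ∷ none ∷ []
westward (tee _ _ stemUp) = none ∷ partner 1st ∷ partner 2nd ∷ none ∷ []
westward (tee _ _ stemRight) = none ∷ none ∷ none ∷ partner 2nd ∷ []
westward (tee _ _ stemLeft) = none ∷ partner 4th ∷ none ∷ none ∷ []

southward : ∀ p → All (Matched (_⟶_via down) south north (labels p)) (labels p)
southward (mono _ _) = none ∷ []
southward (tee _ _ stemDown) = none ∷ partner 4th ∷ none ∷ none ∷ []
southward (tee _ _ stemUp) = none ∷ none ∷ none ∷ partner 2nd ∷ []
southward (tee _ _ stemRight) = partner 2nd ∷ partner 3rd ∷ none ∷ none ∷ []
southward (tee _ _ stemLeft) = partner 2nd ∷ partner 3rd ∷ none ∷ none ∷ []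

northward : ∀ p → All (Matched (_⟵_via down) north south (labels p)) (labels p)
northward (mono _ _) = none ∷ []
northward (tee _ _ stemDown) = none ∷ none ∷ none ∷ partner 2nd ∷ []
northward (tee _ _ stemUp) = none ∷ partner 4th ∷ none ∷ none ∷ []
northward (tee _ _ stemRight) = none ∷ partner 1st ∷ partner 2nd ∷ none ∷ []
northward (tee _ _ stemLeft) = none ∷ partner 1st ∷ partner 2nd ∷ none ∷ []

matched-all : ∀ {_⇝_ side side′} → (∀ p → All (Matched _⇝_ side side′ (labels p)) (labels p)) →
  ∀ ps {x} → x ∈ allLabels ps → Matched _⇝_ side side′ (allLabels ps) x
matched-all matched ps x∈ with find (∈-concatMap⁻ labels {xs = ps} x∈)
... | p , p∈ , x∈p with lookup (matched p) x∈p
...   | inj₁ b = inj₁ b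
...   | inj₂ (c′ , l′ , step , l′∈ , eq) =
  inj₂ (c′ , l′ , step , ∈-concatMap⁺ labels (lose p∈ l′∈) , eq)

-- Reading a tiling as a walk through its columns

labelAt : List (Cell × Label) → Cell → Label
-- Default for uncovered cells. Every cell of a tiled rectangle is covered, and there `labelAt-∈`
-- yields a genuine label.
labelAt [] c = single
labelAt ((d , l) ∷ L) c with c ≟ᶜ d
... | yes _ = l
... | no _ = labelAt L c

labelAt-∈ : ∀ {L c} → c ∈ map proj₁ L → (c , labelAt L c) ∈ L
labelAt-∈ {(d , l) ∷ L} {c} c∈ with c ≟ᶜ d
labelAt-∈ c∈ | yes refl = here refl
labelAt-∈ (here refl) | no c≢d = contradiction refl c≢d
labelAt-∈ (there c∈) | no c≢d = there (labelAt-∈ c∈)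

labelAt-unique : ∀ {L c l} → occ c (map proj₁ L) ≡ 1 → (c , l) ∈ L → labelAt L c ≡ l
labelAt-unique {(d , l) ∷ L} {c} once c∈ with c ≟ᶜ d
labelAt-unique once (here refl) | yes refl = refl
labelAt-unique {(d , _) ∷ L} once (there c∈) | yes refl =
  contradiction (∈⇒occ (∈-map⁺ proj₁ c∈))
    (<⇒≱ (≤-reflexive (trans (sym (occ-here d (map proj₁ L))) once)))
labelAt-unique once (here refl) | no c≢d = contradiction refl c≢d
labelAt-unique {_ ∷ L} once (there c∈) | no c≢d =
  labelAt-unique (trans (sym (occ-there (map proj₁ L) c≢d)) once) c∈

-- The index is the colour of the edge above the remaining squares, so a column is a run of an
-- automaton reading downwards that must stop at a blank bottom edge.
data Column : Colour → ∀ {m} → Vec Label m → Set where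
  []  : Column blank []
  _∷_ : ∀ l {m} {ls : Vec Label m} → Column (south l) ls → Column (north l) (l ∷ ls)

singles# : Label → ℕ
singles# single = 1
singles# _ = 0

singles : ∀ {m} → Vec Label m → ℕ
singles [] = 0
singles (l ∷ ls) = singles# l + singles ls

readDown : (ℕ → Label) → ∀ m → Vec Label m
readDown f zero = []
readDown f (suc m) = f 0 ∷ readDown (f ∘ suc) m

readDown-Column : ∀ f m → (∀ r → suc r < suc m → south (f r) ≡ north (f (suc r))) →
  south (f m) ≡ blank → Column (north (f 0)) (readDown f (suc m))
readDown-Column f zero _ bottom = f 0 ∷ subst (λ c → Column c []) (sym bottom) []
readDown-Column f (suc m) inner bottom = f 0 ∷ subst (λ c → Column c (readDown (f ∘ suc) (suc m)))
  (sym (inner 0 (s≤s (s≤s z≤n))))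
  (readDown-Column (f ∘ suc) m (λ r r< → inner (suc r) (s≤s r<)) bottom)

readDown-singles : ∀ (f : Cell → Label) m →
  singles (readDown (λ r → f (r , 0)) m) ≡ sum (map (singles# ∘ f) (column m))
readDown-singles f zero = refl
readDown-singles f (suc m) = cong (singles# (f (0 , 0)) +_)
  (trans (readDown-singles (f ∘ down) m) (cong sum (map-∘ (column m))))

readDown-cong : ∀ {f g : ℕ → Label} (h k : Label → Colour) m → (∀ r → r < m → h (f r) ≡ k (g r)) →
  mapᵛ h (readDown f m) ≡ mapᵛ k (readDown g m)
readDown-cong h k zero _ = refl
readDown-cong h k (suc m) eq =
  cong₂ _∷_ (eq 0 (s≤s z≤n)) (readDown-cong h k m (λ r r< → eq (suc r) (s≤s r<)))

-- The successive columns of a labelled rectangle: n columns with k monominoes in total, the first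
-- one having west sides w.
data Path {m} : Vec Colour m → (n k : ℕ) → Set where
  end  : ∀ {w} → Path w 0 0
  step : ∀ {ls n k} → Column blank ls → Path (mapᵛ east ls) n k →
         Path (mapᵛ west ls) (suc n) (singles ls + k)

-- The columns are peeled off by replacing `f` with `f ∘ right`. The word `w` is constrained only
-- for `0 < n`, since after the last column no square is left to determine it.
toPath : ∀ m n (f : Cell → Label) {w} →
  (0 < n → w ≡ mapᵛ west (readDown (λ r → f (r , 0)) m)) →
  (∀ s → s < n → Column blank (readDown (λ r → f (r , s)) m)) →
  (∀ r s → r < m → suc s < n → east (f (r , s)) ≡ west (f (r , suc s))) →
  Path w n (sum (map (singles# ∘ f) (rect m n)))
toPath m zero f w≡ col match = end
toPath m (suc n) f w≡ col match rewrite w≡ (s≤s z≤n)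
  | map-++ (singles# ∘ f) (column m) (map right (rect m n))
  | sum-++ (map (singles# ∘ f) (column m)) (map (singles# ∘ f) (map right (rect m n)))
  | sym (readDown-singles f m)
  | sym (map-∘ {g = singles# ∘ f} {f = right} (rect m n))
  = step (col 0 (s≤s z≤n))
      (toPath m n (f ∘ right)
        (λ 0<n → readDown-cong east west m (λ r r< → match r 0 r< (s≤s 0<n)))
        (λ s s< → col (suc s) (s≤s s<))
        (λ r s r< s< → match r (suc s) r< (s≤s s<)))

monoCells : List Piece → List Cell
monoCells [] = []
monoCells (mono i j ∷ ps) = (i , j) ∷ monoCells ps
monoCells (tee _ _ _ ∷ ps) = monoCells ps

length-monoCells : ∀ ps → length (monoCells ps) ≡ monos ps
length-monoCells [] = refl
length-monoCells (mono _ _ ∷ ps) = cong suc (length-monoCells ps)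
length-monoCells (tee _ _ _ ∷ ps) = length-monoCells ps

single∈⇒mono : ∀ ps {c} → (c , single) ∈ allLabels ps → c ∈ monoCells ps
single∈⇒mono (mono _ _ ∷ ps) (here refl) = here refl
single∈⇒mono (mono _ _ ∷ ps) (there c∈) = there (single∈⇒mono ps c∈)
single∈⇒mono (tee i j o ∷ ps) c∈ with ∈-++⁻ (labels (tee i j o)) c∈
... | inj₁ c∈ˡ = contradiction c∈ˡ (single∉ o)
  where
  single∉ : ∀ o {c} → ¬ (c , single) ∈ labels (tee i j o)
  single∉ stemDown (there (there (there (there ()))))
  single∉ stemUp (there (there (there (there ()))))
  single∉ stemRight (there (there (there (there ()))))
  single∉ stemLeft (there (there (there (there ()))))
... | inj₂ c∈ʳ = single∈⇒mono ps c∈ʳ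

module _ {m n ps} (tiling : Tiling m n ps) where

  label : Cell → Label
  label = labelAt (allLabels ps)

  private
    once : ∀ {c} → InRect m n c → occ c (map proj₁ (allLabels ps)) ≡ 1
    once {c} (r< , s<) = trans (cong (occ c) (sym (cells≡allLabels ps))) (proj₂ tiling _ _ r< s<)

    label-∈ : ∀ {c} → InRect m n c → (c , label c) ∈ allLabels ps
    label-∈ c∈ = labelAt-∈ (occ⇒∈ (map proj₁ (allLabels ps)) (≤-reflexive (sym (once c∈))))

    label-inRect : ∀ {c l} → (c , l) ∈ allLabels ps → InRect m n c
    label-inRect {c} x∈ =
      AllIn⁻ (proj₁ tiling) (subst (c ∈_) (sym (cells≡allLabels ps)) (∈-map⁺ proj₁ x∈))

  -- If either square colours the common edge, its partner in the same piece sits on the other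
  -- square, and uniqueness of labels transfers the colour. Otherwise both sides are blank. Hence
  -- matching is required in both directions.
  sides-agree : ∀ {f side side′} → Injective _≡_ _≡_ f →
    (∀ p → All (Matched (_⟶_via f) side side′ (labels p)) (labels p)) →
    (∀ p → All (Matched (_⟵_via f) side′ side (labels p)) (labels p)) →
    ∀ {c} → InRect m n c → InRect m n (f c) → side (label c) ≡ side′ (label (f c))
  sides-agree {f} {side} {side′} f-inj fwd bwd c∈ fc∈
    with matched-all fwd ps (label-∈ c∈) | matched-all bwd ps (label-∈ fc∈)
  ... | inj₂ (_ , _ , refl , l′∈ , eq) | _ = trans eq (cong side′ (sym (labelAt-unique (once fc∈) l′∈)))
  ... | inj₁ b | inj₁ b′ = trans b (sym b′)
  ... | inj₁ _ | inj₂ (_ , _ , fc≡fd , l∈ , eq) with f-inj fc≡fd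
  ...   | refl = trans (cong side (labelAt-unique (once c∈) l∈)) (sym eq)

  top-blank : ∀ {s} → InRect m n (0 , s) → north (label (0 , s)) ≡ blank
  top-blank c∈ with matched-all northward ps (label-∈ c∈)
  ... | inj₁ b = b
  ... | inj₂ (_ , _ , () , _)

  bottom-blank : ∀ {r s} → suc r ≡ m → InRect m n (r , s) → south (label (r , s)) ≡ blank
  bottom-blank refl c∈ with matched-all southward ps (label-∈ c∈)
  ... | inj₁ b = b
  ... | inj₂ (_ , _ , refl , l∈ , _) = contradiction (proj₁ (label-inRect l∈)) (<-irrefl refl)

  -- A square labelled `single` is the cell of a monomino; double counting over the distinct cells
  -- of the rectangle then gives the bound.
  singles≤monos : sum (map (singles# ∘ label) (rect m n)) ≤ monos ps
  singles≤monos = begin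
    sum (map (singles# ∘ label) (rect m n))             ≤⟨ sum-map-mono (rect m n) (bound ∘ ∈-rect⁻ m n) ⟩
    sum (map (λ c → occ c (monoCells ps)) (rect m n))   ≤⟨ sum-occ≤length (rect m n) (occ-rect≤1 m n) (monoCells ps) ⟩
    length (monoCells ps)                               ≡⟨ length-monoCells ps ⟩
    monos ps                                            ∎
    where
    open ≤-Reasoning
    bound : ∀ {c} → InRect m n c → singles# (label c) ≤ occ c (monoCells ps)
    bound {c} c∈ with label c | label-∈ c∈
    ... | single | l∈ = ∈⇒occ (single∈⇒mono ps l∈)
    ... | limb _ | _ = z≤n
    ... | hub _ | _ = z≤n

Tiling⇒Path : ∀ {m n ps} → Tiling (suc m) n ps → ∃₂ λ w k → Path {suc m} w n k × k ≤ monos ps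
Tiling⇒Path {m} {n} {ps} t = _ , _ , toPath (suc m) n f (λ _ → refl) columns across , singles≤monos {ps = ps} t
  where
  f : Cell → Label
  f = label {ps = ps} t
  columns : ∀ s → s < n → Column blank (readDown (λ r → f (r , s)) (suc m))
  columns s s< = subst (λ c → Column c (readDown (λ r → f (r , s)) (suc m)))
    (top-blank {ps = ps} t (s≤s z≤n , s<))
    (readDown-Column (λ r → f (r , s)) m
      (λ r r< → sides-agree {ps = ps} t down-injective southward northward (<⇒≤ r< , s<) (r< , s<))
      (bottom-blank {ps = ps} t refl (≤-refl , s<)))
  across : ∀ r s → r < suc m → suc s < n → east (f (r , s)) ≡ west (f (r , suc s))
  across r s r< s< = sides-agree {ps = ps} t right-injective eastward westward (r< , <⇒≤ s<) (r< , s<)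

-- Sets of boundary words

-- A ternary trie, so that union, inclusion and the passage through a column are computed branch by
-- branch rather than word by word.
data WordSet : ℕ → Set where
  ∅    : ∀ {n} → WordSet n
  ε    : WordSet 0
  node : ∀ {n} (b i o : WordSet n) → WordSet (suc n)

infix 4 _∈ʷ_
data _∈ʷ_ : ∀ {n} → Vec Colour n → WordSet n → Set where
  ε       : [] ∈ʷ ε
  blank   : ∀ {n w} {b i o : WordSet n} → w ∈ʷ b → blank ∷ w ∈ʷ node b i o
  inward  : ∀ {n w} {b i o : WordSet n} → w ∈ʷ i → inward ∷ w ∈ʷ node b i o
  outward : ∀ {n w} {b i o : WordSet n} → w ∈ʷ o → outward ∷ w ∈ʷ node b i o

full : ∀ n → WordSet n
full zero = ε
full (suc n) = node (full n) (full n) (full n)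

∈-full : ∀ {n} (w : Vec Colour n) → w ∈ʷ full n
∈-full [] = ε
∈-full (blank ∷ w) = blank (∈-full w)
∈-full (inward ∷ w) = inward (∈-full w)
∈-full (outward ∷ w) = outward (∈-full w)

-- Keeps sets pruned: without it, dead prefixes would accumulate along the 45 levels for width 11.
node′ : ∀ {n} (b i o : WordSet n) → WordSet (suc n)
node′ ∅ ∅ ∅ = ∅
node′ b i o = node b i o

∈-node′ : ∀ {n} (b i o : WordSet n) {w} → w ∈ʷ node b i o → w ∈ʷ node′ b i o
∈-node′ ∅ ∅ ∅ (blank ())
∈-node′ ∅ ∅ ∅ (inward ())
∈-node′ ∅ ∅ ∅ (outward ())
∈-node′ ∅ ∅ ε p = p
∈-node′ ∅ ∅ (node _ _ _) p = p
∈-node′ ∅ ε _ p = p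
∈-node′ ∅ (node _ _ _) _ p = p
∈-node′ ε _ _ p = p
∈-node′ (node _ _ _) _ _ p = p

infixr 6 _∪_
_∪_ : ∀ {n} → WordSet n → WordSet n → WordSet n
∅ ∪ y = y
ε ∪ y = ε
node b i o ∪ ∅ = node b i o
node b i o ∪ node b′ i′ o′ = node (b ∪ b′) (i ∪ i′) (o ∪ o′)

∈-∪ˡ : ∀ {n} {x : WordSet n} y {w} → w ∈ʷ x → w ∈ʷ x ∪ y
∈-∪ˡ y ε = ε
∈-∪ˡ ∅ p@(blank _) = p
∈-∪ˡ ∅ p@(inward _) = p
∈-∪ˡ ∅ p@(outward _) = p
∈-∪ˡ (node b′ _ _) (blank p) = blank (∈-∪ˡ b′ p)
∈-∪ˡ (node _ i′ _) (inward p) = inward (∈-∪ˡ i′ p)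
∈-∪ˡ (node _ _ o′) (outward p) = outward (∈-∪ˡ o′ p)

∈-∪ʳ : ∀ {n} x {y : WordSet n} {w} → w ∈ʷ y → w ∈ʷ x ∪ y
∈-∪ʳ ∅ p = p
∈-∪ʳ ε ε = ε
∈-∪ʳ (node b _ _) (blank p) = blank (∈-∪ʳ b p)
∈-∪ʳ (node _ i _) (inward p) = inward (∈-∪ʳ i p)
∈-∪ʳ (node _ _ o) (outward p) = outward (∈-∪ʳ o p)

infix 4 _⊆?_
-- Sound but not complete: a `node` is rejected against `∅` even if it contains no word.
_⊆?_ : ∀ {n} → WordSet n → WordSet n → Bool
∅ ⊆? y = true
ε ⊆? ε = true
ε ⊆? ∅ = false
node b i o ⊆? ∅ = false
node b i o ⊆? node b′ i′ o′ = (b ⊆? b′) ∧ (i ⊆? i′) ∧ (o ⊆? o′)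

∧-true : ∀ {a b} → a ∧ b ≡ true → a ≡ true × b ≡ true
∧-true {true} eq = refl , eq

⊆?-sound : ∀ {n} {x y : WordSet n} → (x ⊆? y) ≡ true → ∀ {w} → w ∈ʷ x → w ∈ʷ y
⊆?-sound {y = ε} _ ε = ε
⊆?-sound {x = node b i o} {node b′ i′ o′} eq p with ∧-true {b ⊆? b′} eq
... | b⊆ , eq′ with ∧-true {i ⊆? i′} eq′ | p
...   | _ | blank q = blank (⊆?-sound b⊆ q)
...   | i⊆ , _ | inward q = inward (⊆?-sound i⊆ q)
...   | _ , o⊆ | outward q = outward (⊆?-sound o⊆ q)

-- East sides of the monomino-free columns whose west sides lie in the given set and whose topmost
-- north side has the given colour.
advance : ∀ {n} → Colour → WordSet n → WordSet n
advance _ ∅ = ∅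
advance blank ε = ε
advance inward ε = ∅
advance outward ε = ∅
advance blank (node b i o) =
  node′ (advance inward b ∪ advance blank o) (advance blank b) (advance outward i)
advance inward (node b i o) =
  node′ (advance outward i) ∅ (advance outward b ∪ advance blank i)
advance outward (node b i o) = node′ (advance blank b) ∅ ∅

-- A monomino differs from a westward limb only in its west side, so it can be traded for one by
-- bumping that side from blank to outward.
west⁺ : Label → Colour
west⁺ single = outward
west⁺ l = west l

∈-advance-blank : ∀ {n} (b i o : WordSet n) {w} →
  w ∈ʷ node (advance inward b ∪ advance blank o) (advance blank b) (advance outward i) →
  w ∈ʷ advance blank (node b i o)
∈-advance-blank b i o = ∈-node′ (advance inward b ∪ advance blank o) (advance blank b) (advance outward i)

∈-advance-inward : ∀ {n} (b i o : WordSet n) {w} →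
  w ∈ʷ node (advance outward i) ∅ (advance outward b ∪ advance blank i) →
  w ∈ʷ advance inward (node b i o)
∈-advance-inward b i o = ∈-node′ (advance outward i) ∅ (advance outward b ∪ advance blank i)

-- One case per label. A blank north side allows `single`, `limb E`, `limb S`, `limb W` and `hub N`;
-- an inward one allows the other three hubs; an outward one only `limb N`. Since `west⁺` makes the
-- west side of `single` outward, it shares the branch of `limb W`.
∈-advance : ∀ {n c} {ls : Vec Label n} (X : WordSet n) → Column c ls →
  mapᵛ west⁺ ls ∈ʷ X → mapᵛ east ls ∈ʷ advance c X
∈-advance ε [] ε = ε
∈-advance (node b i o) (single ∷ col) (outward p) =
  ∈-advance-blank b i o (blank (∈-∪ʳ (advance inward b) (∈-advance o col p)))
∈-advance (node b i o) (limb N ∷ col) (blank p) = ∈-node′ (advance blank b) ∅ ∅ (blank (∈-advance b col p))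
∈-advance (node b i o) (limb E ∷ col) (blank p) = ∈-advance-blank b i o (inward (∈-advance b col p))
∈-advance (node b i o) (limb S ∷ col) (blank p) =
  ∈-advance-blank b i o (blank (∈-∪ˡ (advance blank o) (∈-advance b col p)))
∈-advance (node b i o) (limb W ∷ col) (outward p) =
  ∈-advance-blank b i o (blank (∈-∪ʳ (advance inward b) (∈-advance o col p)))
∈-advance (node b i o) (hub N ∷ col) (inward p) = ∈-advance-blank b i o (outward (∈-advance i col p))
∈-advance (node b i o) (hub E ∷ col) (inward p) = ∈-advance-inward b i o (blank (∈-advance i col p))
∈-advance (node b i o) (hub S ∷ col) (inward p) =
  ∈-advance-inward b i o (outward (∈-∪ʳ (advance outward b) (∈-advance i col p)))
∈-advance (node b i o) (hub W ∷ col) (blank p) =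
  ∈-advance-inward b i o (outward (∈-∪ˡ (advance blank i) (∈-advance b col p)))

-- Accounts for one monomino: exactly one blank letter is turned into outward, as `west⁺` does at
-- each `single`.
bump : ∀ {n} → WordSet n → WordSet n
bump ∅ = ∅
bump ε = ∅
bump (node b i o) = node′ (bump b) (bump i) (bump o ∪ b)

data Bump : ∀ {n} → Vec Colour n → Vec Colour n → Set where
  here  : ∀ {n} {w : Vec Colour n} → Bump (blank ∷ w) (outward ∷ w)
  there : ∀ {n} {v w : Vec Colour n} c → Bump v w → Bump (c ∷ v) (c ∷ w)

∈-bump : ∀ {n} {v w : Vec Colour n} X → Bump v w → v ∈ʷ X → w ∈ʷ bump X
∈-bump (node b i o) here (blank p) =
  ∈-node′ (bump b) (bump i) (bump o ∪ b) (outward (∈-∪ʳ (bump o) p))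
∈-bump (node b i o) (there _ q) (blank p) =
  ∈-node′ (bump b) (bump i) (bump o ∪ b) (blank (∈-bump b q p))
∈-bump (node b i o) (there _ q) (inward p) =
  ∈-node′ (bump b) (bump i) (bump o ∪ b) (inward (∈-bump i q p))
∈-bump (node b i o) (there _ q) (outward p) =
  ∈-node′ (bump b) (bump i) (bump o ∪ b) (outward (∈-∪ˡ b (∈-bump o q p)))

-- Certificates for the potential

infixl 7 _‼_
_‼_ : ∀ {m} → List (WordSet m) → ℕ → WordSet m
-- Levels past the end are empty, so `advances?` forces the last listed level to have no
-- monomino-free continuation.
[] ‼ t = ∅
(X ∷ Xs) ‼ zero = X
(X ∷ Xs) ‼ suc t = Xs ‼ t

‼-drop : ∀ {m} P (Xs : List (WordSet m)) t → drop P Xs ‼ t ≡ Xs ‼ (P + t)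
‼-drop zero Xs t = refl
‼-drop (suc P) [] t = refl
‼-drop (suc P) (X ∷ Xs) t = ‼-drop P Xs t

∈-‼⇒< : ∀ {m} (Xs : List (WordSet m)) t {w} → w ∈ʷ Xs ‼ t → t < length Xs
∈-‼⇒< (X ∷ Xs) zero p = s≤s z≤n
∈-‼⇒< (X ∷ Xs) (suc t) p = s≤s (∈-‼⇒< Xs t p)

advances? : ∀ {m} → List (WordSet m) → Bool
advances? [] = true
advances? (X ∷ Xs) = (advance blank X ⊆? (Xs ‼ 0)) ∧ advances? Xs

advances?-sound : ∀ {m} (Xs : List (WordSet m)) → advances? Xs ≡ true →
  ∀ t w → w ∈ʷ advance blank (Xs ‼ t) → w ∈ʷ Xs ‼ suc t
advances?-sound (X ∷ Xs) eq t w p with ∧-true {advance blank X ⊆? (Xs ‼ 0)} eq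
advances?-sound (X ∷ Xs) eq zero w p | ok , _ = ⊆?-sound ok p
advances?-sound (X ∷ Xs) eq (suc t) w p | _ , oks = advances?-sound Xs oks t w p

bumps? : ∀ {m} → List (WordSet m) → List (WordSet m) → Bool
bumps? [] Ys = true
bumps? (X ∷ Xs) Ys = (bump X ⊆? (Ys ‼ 0)) ∧ bumps? Xs (drop 1 Ys)

bumps?-sound : ∀ {m} (Xs Ys : List (WordSet m)) → bumps? Xs Ys ≡ true →
  ∀ t w → w ∈ʷ bump (Xs ‼ t) → w ∈ʷ Ys ‼ t
bumps?-sound (X ∷ Xs) Ys eq t w p with ∧-true {bump X ⊆? (Ys ‼ 0)} eq
bumps?-sound (X ∷ Xs) Ys eq zero w p | ok , _ = ⊆?-sound ok p
bumps?-sound (X ∷ Xs) Ys eq (suc t) w p | _ , oks =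
  subst (w ∈ʷ_) (‼-drop 1 Ys t) (bumps?-sound Xs (drop 1 Ys) oks t w p)

-- If Xs certifies P, then along a path the word after n columns and k monominoes stays in
-- Xs ‼ (n ∸ P * k), which is empty as soon as n ∸ P * k reaches the length of Xs.
certifies : ∀ {m} → ℕ → List (WordSet m) → Bool
certifies {m} P Xs = (full m ⊆? (Xs ‼ 0)) ∧ advances? Xs ∧ bumps? (drop P Xs) Xs

module _ {m} (P : ℕ) (Xs : List (WordSet m)) (cert : certifies P Xs ≡ true) where

  private
    full⊆ : ∀ w → w ∈ʷ Xs ‼ 0
    full⊆ w = ⊆?-sound (proj₁ (∧-true {full m ⊆? (Xs ‼ 0)} cert)) (∈-full w)

    advances : advances? Xs ≡ true
    advances = proj₁ (∧-true {advances? Xs} (proj₂ (∧-true {full m ⊆? (Xs ‼ 0)} cert)))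

    bumps : bumps? (drop P Xs) Xs ≡ true
    bumps = proj₂ (∧-true {advances? Xs} (proj₂ (∧-true {full m ⊆? (Xs ‼ 0)} cert)))

    bump-level : ∀ {t v w} → Bump v w → v ∈ʷ Xs ‼ t → w ∈ʷ Xs ‼ (t ∸ P)
    bump-level {t} {v} {w} b v∈ with P ≤? t
    -- The truncated difference is 0, and level 0 contains every word.
    ... | no P≰t rewrite m≤n⇒m∸n≡0 (<⇒≤ (≰⇒> P≰t)) = full⊆ w
    ... | yes P≤t = bumps?-sound (drop P Xs) Xs bumps (t ∸ P) w
      (∈-bump (drop P Xs ‼ (t ∸ P)) b
        (subst (v ∈ʷ_) (sym (trans (‼-drop P Xs (t ∸ P)) (cong (Xs ‼_) (m+[n∸m]≡n P≤t)))) v∈))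

  -- Each `single` costs one bump and hence `P` levels. The predicate `R` is arbitrary so that
  -- letters already treated can be absorbed into it while the induction moves down the column.
  fill-singles : ∀ {n} (R : ℕ → Vec Colour n → Set) → (∀ {t v w} → Bump v w → R t v → R (t ∸ P) w) →
    ∀ (ls : Vec Label n) {t} → R t (mapᵛ west ls) → R (t ∸ P * singles ls) (mapᵛ west⁺ ls)
  fill-singles R R-bump [] {t} p = subst (λ k → R (t ∸ k) []) (sym (*-zeroʳ P)) p
  fill-singles R R-bump (single ∷ ls) {t} p =
    subst (λ k → R k (outward ∷ mapᵛ west⁺ ls))
      (trans (∸-+-assoc t P (P * singles ls)) (cong (t ∸_) (sym (*-suc P (singles ls)))))
      (fill-singles (λ t w → R t (outward ∷ w)) (R-bump ∘ there outward) ls (R-bump here p))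
  fill-singles R R-bump (limb N ∷ ls) p = fill-singles (λ t w → R t (blank ∷ w)) (R-bump ∘ there blank) ls p
  fill-singles R R-bump (limb E ∷ ls) p = fill-singles (λ t w → R t (blank ∷ w)) (R-bump ∘ there blank) ls p
  fill-singles R R-bump (limb S ∷ ls) p = fill-singles (λ t w → R t (blank ∷ w)) (R-bump ∘ there blank) ls p
  fill-singles R R-bump (limb W ∷ ls) p = fill-singles (λ t w → R t (outward ∷ w)) (R-bump ∘ there outward) ls p
  fill-singles R R-bump (hub N ∷ ls) p = fill-singles (λ t w → R t (inward ∷ w)) (R-bump ∘ there inward) ls p
  fill-singles R R-bump (hub E ∷ ls) p = fill-singles (λ t w → R t (inward ∷ w)) (R-bump ∘ there inward) ls p
  fill-singles R R-bump (hub S ∷ ls) p = fill-singles (λ t w → R t (inward ∷ w)) (R-bump ∘ there inward) ls p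
  fill-singles R R-bump (hub W ∷ ls) p = fill-singles (λ t w → R t (blank ∷ w)) (R-bump ∘ there blank) ls p

  -- A column with `j` monominoes first lowers the level by `P * j`, by bumping, and then raises it
  -- by one, by advancing. At the end the level is still below `length Xs`.
  path-bound : ∀ {w n k} → Path w n k → ∀ {t} → w ∈ʷ Xs ‼ t → t + n ≤ P * k + length Xs
  path-bound end {t} p rewrite *-zeroʳ P | +-identityʳ t = <⇒≤ (∈-‼⇒< Xs t p)
  path-bound (step {ls} {n} {k} col path) {t} p = begin
    t + suc n                                    ≡⟨ +-suc t n ⟩
    -- Truncation errs in the safe direction: `t` is at most `P * j + (t ∸ P * j)`.
    suc (t + n)                                  ≤⟨ s≤s (+-monoˡ-≤ n (m≤n+m∸n t (P * j))) ⟩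
    suc (P * j + (t ∸ P * j) + n)                ≡⟨ cong suc (+-assoc (P * j) _ n) ⟩
    suc (P * j + ((t ∸ P * j) + n))              ≡⟨ +-suc (P * j) _ ⟨
    P * j + (suc (t ∸ P * j) + n)                ≤⟨ +-monoʳ-≤ (P * j) (path-bound path next) ⟩
    P * j + (P * k + length Xs)                  ≡⟨ +-assoc (P * j) (P * k) _ ⟨
    P * j + P * k + length Xs                    ≡⟨ cong (_+ length Xs) (*-distribˡ-+ P j k) ⟨
    P * (j + k) + length Xs                      ∎
    where
    open ≤-Reasoning
    j = singles ls
    next : mapᵛ east ls ∈ʷ Xs ‼ suc (t ∸ P * j)
    next = advances?-sound Xs advances (t ∸ P * j) _
      (∈-advance (Xs ‼ (t ∸ P * j)) col
        (fill-singles (λ t w → w ∈ʷ Xs ‼ t) (λ {t} → bump-level {t}) ls p))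

  Path⇒length≤ : ∀ {w n k} → Path w n k → n ≤ P * k + length Xs
  Path⇒length≤ {w} path = path-bound path (full⊆ w)

-- `Ds` is added from the second level onwards. The first level is the full set in every use, which
-- explains the offset `suc P` in `levels`.
chain : ∀ {m} → ℕ → List (WordSet m) → WordSet m → List (WordSet m)
chain zero Ds X = []
chain (suc K) Ds X = X ∷ chain K (drop 1 Ds) (advance blank X ∪ (Ds ‼ 0))

-- Iterates towards the least certificate: each round feeds the bumped high levels of the previous
-- round back into the low levels.
levels : ∀ m (P K rounds : ℕ) → List (WordSet m)
levels m P K zero = chain K [] (full m)
levels m P K (suc r) = chain K (map bump (drop (suc P) (levels m P K r))) (full m)

-- Periodic tilings

shift : ℕ → List Cell → List Cell
shift zero cs = cs
shift (suc d) cs = map right (shift d cs)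

shift-++ : ∀ d xs ys → shift d (xs ++ ys) ≡ shift d xs ++ shift d ys
shift-++ zero xs ys = refl
shift-++ (suc d) xs ys = trans (cong (map right) (shift-++ d xs ys)) (map-++ right (shift d xs) (shift d ys))

shift-≈ : ∀ d {xs ys} → xs ≈ ys → shift d xs ≈ shift d ys
shift-≈ zero p = p
shift-≈ (suc d) p = map-right-≈ (shift-≈ d p)

rect-++ : ∀ m d n → rect m (d + n) ≡ rect m d ++ shift d (rect m n)
rect-++ m zero n = refl
rect-++ m (suc d) n = begin
  column m ++ map right (rect m (d + n))                          ≡⟨ cong (λ cs → column m ++ map right cs) (rect-++ m d n) ⟩
  column m ++ map right (rect m d ++ shift d (rect m n))          ≡⟨ cong (column m ++_) (map-++ right (rect m d) _) ⟩
  column m ++ map right (rect m d) ++ shift (suc d) (rect m n)    ≡⟨ ++-assoc (column m) _ _ ⟨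
  rect m (suc d) ++ shift (suc d) (rect m n)                      ∎
  where open ≡-Reasoning

moveRight : Piece → Piece
moveRight (mono i j) = mono i (suc j)
moveRight (tee i j o) = tee i (suc j) o

cells-moveRight : ∀ ps → concatMap cells (map moveRight ps) ≡ map right (concatMap cells ps)
cells-moveRight [] = refl
cells-moveRight (p ∷ ps) rewrite map-++ right (cells p) (concatMap cells ps) =
  cong₂ _++_ (one p) (cells-moveRight ps)
  where
  one : ∀ p → cells (moveRight p) ≡ map right (cells p)
  one (mono _ _) = refl
  one (tee _ _ stemDown) = refl
  one (tee _ _ stemUp) = refl
  one (tee _ _ stemRight) = refl
  one (tee _ _ stemLeft) = refl

monos-moveRight : ∀ ps → monos (map moveRight ps) ≡ monos ps
monos-moveRight [] = refl
monos-moveRight (mono _ _ ∷ ps) = cong suc (monos-moveRight ps)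
monos-moveRight (tee _ _ _ ∷ ps) = monos-moveRight ps

shiftPieces : ℕ → List Piece → List Piece
shiftPieces zero ps = ps
shiftPieces (suc d) ps = map moveRight (shiftPieces d ps)

cells-shiftPieces : ∀ d ps → concatMap cells (shiftPieces d ps) ≡ shift d (concatMap cells ps)
cells-shiftPieces zero ps = refl
cells-shiftPieces (suc d) ps =
  trans (cells-moveRight (shiftPieces d ps)) (cong (map right) (cells-shiftPieces d ps))

monos-shiftPieces : ∀ d ps → monos (shiftPieces d ps) ≡ monos ps
monos-shiftPieces zero ps = refl
monos-shiftPieces (suc d) ps = trans (monos-moveRight (shiftPieces d ps)) (monos-shiftPieces d ps)

monos-++ : ∀ ps qs → monos (ps ++ qs) ≡ monos ps + monos qs
monos-++ [] qs = refl
monos-++ (mono _ _ ∷ ps) qs = cong suc (monos-++ ps qs)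
monos-++ (tee _ _ _ ∷ ps) qs = monos-++ ps qs

fillMonos : List Cell → List Piece
fillMonos = map (λ (i , j) → mono i j)

cells-fillMonos : ∀ cs → concatMap cells (fillMonos cs) ≡ cs
cells-fillMonos [] = refl
cells-fillMonos (c ∷ cs) = cong (c ∷_) (cells-fillMonos cs)

monos-fillMonos : ∀ cs → monos (fillMonos cs) ≡ length cs
monos-fillMonos [] = refl
monos-fillMonos (_ ∷ cs) = cong suc (monos-fillMonos cs)

length-shift : ∀ d cs → length (shift d cs) ≡ length cs
length-shift zero cs = refl
length-shift (suc d) cs = trans (length-map right (shift d cs)) (length-shift d cs)

length-rect : ∀ m n → length (rect m n) ≡ n * m
length-rect m zero = refl
length-rect m (suc n) = trans (length-++ (column m))
  (cong₂ _+_ (length-column m) (trans (length-map right (rect m n)) (length-rect m n)))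
  where
  length-column : ∀ m → length (column m) ≡ m
  length-column zero = refl
  length-column (suc m) = cong suc (trans (length-map down (column m)) (length-column m))

uncovered : ℕ → List Cell → List Cell
uncovered m O = filter (λ c → occ c O ≟ 0) (rect m 2)

-- The overhang O consists of the cells in the first two columns of a block that are covered by
-- pieces of the preceding block.
record PeriodicBlock (m d : ℕ) (O : List Cell) (B : List Piece) : Set where
  constructor periodicBlock
  field
    periodic : SameCounts (concatMap cells B ++ O) (rect m d ++ shift d O)
    closing  : SameCounts (O ++ uncovered m O) (rect m 2)

module _ {m d O B} (block : PeriodicBlock m d O B) where

  open PeriodicBlock block

  private
    F : List Cell
    F = uncovered m O

    endCells : ℕ → List Cell
    endCells j = F ++ shift 2 (rect m j)

  repeated : (q j : ℕ) → List Piece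
  repeated zero j = fillMonos (endCells j)
  repeated (suc q) j = B ++ shiftPieces d (repeated q j)

  -- Induction on the number of blocks: by `periodic`, a block together with the overhang entering
  -- it fills `d` columns and leaves the same overhang, shifted by `d`, for the remaining copies. By
  -- `closing`, monominoes complete the last overhang to two full columns.
  repeated-covers : ∀ q j → O ++ concatMap cells (repeated q j) ≈ rect m (q * d + (2 + j))
  repeated-covers zero j = ≈-trans (≡⇒≈ (begin
      O ++ concatMap cells (fillMonos (endCells j))         ≡⟨ cong (O ++_) (cells-fillMonos (endCells j)) ⟩
      O ++ F ++ shift 2 (rect m j)                          ≡⟨ ++-assoc O F _ ⟨
      (O ++ F) ++ shift 2 (rect m j)                        ∎))
    (≈-trans (++-≈ (SameCounts⇒≈ (O ++ F) (rect m 2) closing) (≡⇒≈ refl)) (≡⇒≈ (sym (rect-++ m 2 j))))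
    where open ≡-Reasoning
  repeated-covers (suc q) j = ≈-trans (≡⇒≈ (begin
      O ++ concatMap cells (B ++ shiftPieces d R)           ≡⟨ cong (O ++_) (concatMap-++ cells B (shiftPieces d R)) ⟩
      O ++ CB ++ concatMap cells (shiftPieces d R)          ≡⟨ cong (λ cs → O ++ CB ++ cs) (cells-shiftPieces d R) ⟩
      O ++ CB ++ shift d CR                                 ≡⟨ ++-assoc O CB _ ⟨
      (O ++ CB) ++ shift d CR                               ∎))
    (≈-trans (++-≈ (≈-trans (++-comm O CB) (SameCounts⇒≈ (CB ++ O) (rect m d ++ shift d O) periodic)) (≡⇒≈ refl))
    (≈-trans (≡⇒≈ (begin
      (rect m d ++ shift d O) ++ shift d CR                 ≡⟨ ++-assoc (rect m d) _ _ ⟩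
      rect m d ++ shift d O ++ shift d CR                   ≡⟨ cong (rect m d ++_) (shift-++ d O CR) ⟨
      rect m d ++ shift d (O ++ CR)                         ∎))
    (≈-trans (++-≈ (≡⇒≈ refl) (shift-≈ d (repeated-covers q j)))
    (≡⇒≈ (begin
      rect m d ++ shift d (rect m (q * d + (2 + j)))        ≡⟨ rect-++ m d _ ⟨
      rect m (d + (q * d + (2 + j)))                        ≡⟨ cong (rect m) (+-assoc d (q * d) _) ⟨
      rect m (suc q * d + (2 + j))                          ∎)))))
    where
    open ≡-Reasoning
    R = repeated q j
    CB = concatMap cells B
    CR = concatMap cells R

  monos-repeated : ∀ q j → monos (repeated q j) ≡ q * monos B + (length F + j * m)
  monos-repeated zero j = trans (monos-fillMonos (endCells j)) (trans (length-++ F)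
    (cong (length F +_) (trans (length-shift 2 (rect m j)) (length-rect m j))))
  monos-repeated (suc q) j = trans (monos-++ B (shiftPieces d (repeated q j)))
    (trans (cong (monos B +_) (trans (monos-shiftPieces d (repeated q j)) (monos-repeated q j)))
      (sym (+-assoc (monos B) (q * monos B) _)))

  blockTiling : ∀ q j → ∃ λ ps → Tiling m (q * d + (2 + j)) ps ×
    monos ps ≡ length O + (q * monos B + (length F + j * m))
  blockTiling q j = fillMonos O ++ repeated q j ,
    ≈rect⇒Tiling (fillMonos O ++ repeated q j) (≈-trans
      (≡⇒≈ (trans (concatMap-++ cells (fillMonos O) (repeated q j))
        (cong (_++ concatMap cells (repeated q j)) (cells-fillMonos O))))
      (repeated-covers q j)) ,
    trans (monos-++ (fillMonos O) (repeated q j)) (cong₂ _+_ (monos-fillMonos O) (monos-repeated q j))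

  tiling-few-monos : ∀ P .{{_ : NonZero P}} .{{_ : NonZero d}} → 2 ≤ d → monos B * P ≡ d →
    ∃ λ C → ∀ n → ∃ λ ps → Tiling m n ps × monos ps ≤ n / P + C
  tiling-few-monos P 2≤d b*P≡d = C , λ n → go n (n / d) (m≡m%n+[m/n]*n n d)
    where
    -- The monominoes outside the blocks: the initial overhang, the gaps beside the final one, and
    -- fewer than `d + d` full columns.
    C = length O + (length F + (d + d) * m)
    go : ∀ n q → n ≡ n % d + q * d → ∃ λ ps → Tiling m n ps × monos ps ≤ n / P + C
    go n zero n≡ = fillMonos (rect m n) ,
      ≈rect⇒Tiling (fillMonos (rect m n)) (≡⇒≈ (cells-fillMonos (rect m n))) , (begin
        monos (fillMonos (rect m n))             ≡⟨ monos-fillMonos (rect m n) ⟩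
        length (rect m n)                        ≡⟨ length-rect m n ⟩
        n * m                                    ≤⟨ *-monoˡ-≤ m n≤d+d ⟩
        (d + d) * m                              ≤⟨ m≤n+m _ (length F) ⟩
        length F + (d + d) * m                   ≤⟨ m≤n+m _ (length O) ⟩
        C                                        ≤⟨ m≤n+m C (n / P) ⟩
        n / P + C                                ∎)
      where
      open ≤-Reasoning
      n≤d+d : n ≤ d + d
      n≤d+d = begin
        n           ≡⟨ trans n≡ (+-identityʳ _) ⟩
        n % d       ≤⟨ <⇒≤ (m%n<n n d) ⟩
        d           ≤⟨ m≤m+n d d ⟩
        d + d       ∎
    go n (suc q) n≡ = subst (λ w → ∃ λ ps → Tiling m w ps × monos ps ≤ n / P + C) (sym n≡′)
      (let ps , tiling , eq = blockTiling q j in ps , tiling , ≤-trans (≤-reflexive eq) bound)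
      where
      open ≤-Reasoning
      -- One of the `suc q` possible blocks is held back, so that at least two columns remain to
      -- receive the last overhang.
      j = d + n % d ∸ 2
      n≡′ : n ≡ q * d + (2 + j)
      n≡′ = begin-equality
        n                         ≡⟨ n≡ ⟩
        n % d + (d + q * d)       ≡⟨ +-assoc (n % d) d (q * d) ⟨
        n % d + d + q * d         ≡⟨ +-comm (n % d + d) (q * d) ⟩
        q * d + (n % d + d)       ≡⟨ cong (q * d +_) (+-comm (n % d) d) ⟩
        q * d + (d + n % d)       ≡⟨ cong (q * d +_) (m+[n∸m]≡n (≤-trans 2≤d (m≤m+n d (n % d)))) ⟨
        q * d + (2 + j)           ∎
      j≤ : j ≤ d + d
      j≤ = ≤-trans (m∸n≤m (d + n % d) 2) (+-monoʳ-≤ d (<⇒≤ (m%n<n n d)))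
      q*b≤ : q * monos B ≤ n / P
      q*b≤ = begin
        q * monos B               ≡⟨ m*n/n≡m (q * monos B) P ⟨
        q * monos B * P / P       ≡⟨ cong (_/ P) (trans (*-assoc q (monos B) P) (cong (q *_) b*P≡d)) ⟩
        q * d / P                 ≤⟨ /-monoˡ-≤ P (m≤m+n (q * d) (2 + j)) ⟩
        (q * d + (2 + j)) / P     ≡⟨ cong (_/ P) n≡′ ⟨
        n / P                     ∎
      bound : length O + (q * monos B + (length F + j * m)) ≤ n / P + C
      bound = begin
        length O + (q * monos B + (length F + j * m))      ≡⟨ x∙yz≈y∙xz (length O) (q * monos B) _ ⟩
        q * monos B + (length O + (length F + j * m))      ≤⟨ +-mono-≤ q*b≤ (+-monoʳ-≤ (length O) (+-monoʳ-≤ (length F) (*-monoˡ-≤ m j≤))) ⟩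
        n / P + C                                          ∎

-- From the two bounds to the gap formula

tiling-many-monos : ∀ {m} P (Xs : List (WordSet (suc m))) → certifies P Xs ≡ true →
  ∀ {n ps} → Tiling (suc m) n ps → n ≤ P * monos ps + length Xs
tiling-many-monos P Xs cert {n} {ps} tiling with Tiling⇒Path {ps = ps} tiling
... | _ , k , path , k≤ = ≤-trans (Path⇒length≤ P Xs cert path) (+-monoˡ-≤ (length Xs) (*-monoʳ-≤ P k≤))

∣⊖∣≤ : ∀ {a b B C} → a ≤ b + B → b ≤ a + C → ∣ a ⊖ b ∣ ≤ B + C
∣⊖∣≤ {a} {b} {B} {C} a≤ b≤ with ≤-total a b
... | inj₁ a≤b rewrite ∣⊖∣-≤ a≤b = ≤-trans (m≤n+o⇒m∸n≤o b a b≤) (m≤n+m C B)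
... | inj₂ b≤a rewrite ∣m⊖n∣≡∣n⊖m∣ a b | ∣⊖∣-≤ b≤a = ≤-trans (m≤n+o⇒m∸n≤o a b a≤) (m≤m+n B C)

b+[a⊖b]≡a : ∀ a b → pos b +ℤ (a ⊖ b) ≡ pos a
b+[a⊖b]≡a a b = trans (distribʳ-⊖-+-pos b a b)
  (trans (⊖-≥ (m≤m+n b a)) (cong pos (m+n∸m≡n b a)))

GapBounds : (m P : ℕ) .{{_ : NonZero P}} → Set
GapBounds m P =
  (∃ λ K → ∀ {n} ps → Tiling m n ps → n ≤ P * monos ps + K) ×
  (∃ λ C → ∀ n → ∃ λ ps → Tiling m n ps × monos ps ≤ n / P + C)

gapFormula : ∀ m P .{{_ : NonZero P}} → GapBounds m P →
  Σ[ e ∈ (ℕ → ℤ) ] (BoundedPos e × (∀ n → GapFormula m P e n))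
gapFormula m P ((K , many) , (C , few)) = deviation λ n →
    let ps , tiling , _ = few n in gapNumber {ps = ps} tiling
  where
  -- With the gap numbers as a parameter, the exhaustive search behind them stays folded while the
  -- bounds are checked.
  deviation : (∀ n → ∃ (IsGapNumber m n)) →
    Σ[ e ∈ (ℕ → ℤ) ] (BoundedPos e × (∀ n → GapFormula m P e n))
  deviation gapNumbers =
    (λ n → gap n ⊖ n / P) , (C + K , λ n _ → ∣⊖∣≤ (gap≤ n) (≤gap n)) ,
    λ n → gap n , proj₂ (gapNumbers n) , sym (b+[a⊖b]≡a (gap n) (n / P))
    where
    gap : ℕ → ℕ
    gap = proj₁ ∘ gapNumbers
    gap≤ : ∀ n → gap n ≤ n / P + C
    gap≤ n with few n
    ... | ps , tiling , ps≤ = ≤-trans (proj₂ (proj₂ (gapNumbers n)) ps tiling) ps≤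
    ≤gap : ∀ n → n / P ≤ gap n + K
    ≤gap n with gapNumbers n
    ... | k , (ps , tiling , refl) , _ = begin
      n / P                        ≤⟨ /-monoˡ-≤ P (many ps tiling) ⟩
      -- `K` is weakened to `P * K` so that the division becomes exact.
      (P * k + K) / P              ≤⟨ /-monoˡ-≤ P (+-monoʳ-≤ (P * k) (m≤n*m K P)) ⟩
      (P * k + P * K) / P          ≡⟨ cong (_/ P) (trans (sym (*-distribˡ-+ P k K)) (*-comm P _)) ⟩
      (k + K) * P / P              ≡⟨ m*n/n≡m (k + K) P ⟩
      k + K                        ∎
      where open ≤-Reasoning

-- The blocks below trace cycles of minimal mean number of monominoes in the graph of boundary words.

pattern ┬ i j = tee i j stemDown
pattern ┴ i j = tee i j stemUp
pattern ├ i j = tee i j stemRight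
pattern ┤ i j = tee i j stemLeft

-- Empty, because `block₅` tiles the 5 × 10 rectangle with nothing protruding.
overhang₅ : List Cell
overhang₅ = []

block₅ : List Piece
block₅ =
  ┬ 0 0 ∷ ├ 1 0 ∷ ┴ 3 0 ∷ mono 1 2 ∷ ┴ 1 2 ∷ ┬ 3 2 ∷ ┬ 0 3 ∷ ┴ 3 4 ∷ ┴ 0 5 ∷ ┬ 2 5 ∷ ┬ 0 7 ∷
  mono 3 7 ∷ ┴ 3 7 ∷ ┤ 1 8 ∷ []

overhang₇ : List Cell
overhang₇ = (0 , 0) ∷ (0 , 1) ∷ (1 , 0) ∷ (2 , 0) ∷ (3 , 0) ∷ (3 , 1) ∷ []

block₇ : List Piece
block₇ =
  ├ 4 0 ∷ mono 1 1 ∷ ┴ 1 1 ∷ ┴ 3 1 ∷ ┴ 5 1 ∷ ┬ 0 2 ∷ ┴ 2 3 ∷ ┤ 4 3 ∷ ┴ 0 4 ∷ ┬ 2 5 ∷ ├ 4 5 ∷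
  ┬ 0 6 ∷ ┴ 3 6 ∷ ┴ 5 6 ∷ mono 1 8 ∷ ┴ 1 8 ∷ ┬ 3 8 ∷ ┬ 5 8 ∷ ┬ 0 9 ∷ ┴ 3 10 ∷ ┴ 5 10 ∷ ┴ 0 11 ∷
  ┬ 2 11 ∷ ┤ 4 12 ∷ ┬ 0 13 ∷ ┴ 2 13 ∷ []

overhang₁₁ : List Cell
overhang₁₁ = (4 , 0) ∷ (4 , 1) ∷ (5 , 0) ∷ (7 , 0) ∷ (9 , 0) ∷ []

block₁₁ : List Piece
block₁₁ =
  ┬ 0 0 ∷ ├ 1 0 ∷ ┴ 5 0 ∷ ┴ 7 0 ∷ ┴ 9 0 ∷ ┤ 2 1 ∷ ┤ 0 2 ∷ ┴ 4 2 ∷ ┴ 6 2 ∷ ┤ 8 2 ∷ ┬ 3 3 ∷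
  ├ 0 4 ∷ ┤ 5 4 ∷ ├ 8 4 ∷ ┬ 0 5 ∷ ┬ 2 5 ∷ ┬ 4 5 ∷ ┴ 7 5 ∷ ┴ 9 5 ∷ ┬ 6 6 ∷ ┴ 0 7 ∷ ┴ 2 7 ∷
  ┴ 4 7 ∷ ┤ 8 7 ∷ ┴ 6 8 ∷ ┬ 0 9 ∷ ┬ 2 9 ∷ ┬ 4 9 ∷ ├ 8 9 ∷ ┴ 5 10 ∷ ┴ 7 10 ∷ ┴ 9 10 ∷ ┤ 0 11 ∷
  ┬ 3 11 ∷ ┬ 5 12 ∷ ┬ 7 12 ∷ ┬ 9 12 ∷ ├ 0 13 ∷ ┴ 3 13 ∷ ┬ 0 14 ∷ ┬ 2 14 ∷ ┴ 5 14 ∷ ┴ 7 14 ∷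
  ┴ 9 14 ∷ ┤ 0 16 ∷ ├ 3 16 ∷ ┴ 6 16 ∷ ┤ 8 16 ∷ ┬ 3 17 ∷ ┬ 5 17 ∷ ├ 0 18 ∷ ├ 8 18 ∷ ┬ 0 19 ∷
  ┬ 2 19 ∷ ┬ 4 19 ∷ ├ 6 19 ∷ ┴ 9 19 ∷ ┴ 5 20 ∷ ┤ 7 20 ∷ ┤ 0 21 ∷ ┬ 3 21 ∷ ┬ 5 22 ∷ ├ 7 22 ∷
  ┴ 9 22 ∷ ├ 0 23 ∷ ┴ 3 23 ∷ ┤ 6 23 ∷ ┬ 0 24 ∷ ┬ 2 24 ∷ ┬ 9 24 ∷ ┤ 4 25 ∷ ├ 6 25 ∷ ┴ 0 26 ∷
  ┴ 2 26 ∷ ┴ 7 26 ∷ ┴ 9 26 ∷ ├ 4 27 ∷ ┬ 0 28 ∷ ┬ 2 28 ∷ ┬ 4 28 ∷ ┬ 6 28 ∷ mono 7 28 ∷ ┬ 9 28 ∷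
  ┴ 7 29 ∷ ┴ 0 30 ∷ ┤ 2 30 ∷ ┬ 5 30 ∷ ┴ 9 30 ∷ ┤ 6 31 ∷ ┬ 0 32 ∷ ├ 2 32 ∷ ┤ 8 32 ∷ ┤ 1 33 ∷
  ├ 4 33 ∷ ┴ 6 33 ∷ ┬ 4 34 ∷ ├ 8 34 ∷ []

-- Verification for 5, 7 and 11 rows

periodic₅ : PeriodicBlock 5 10 overhang₅ block₅
periodic₅ = periodicBlock (toWitness {a? = sameCounts? _ _} tt) (toWitness {a? = sameCounts? _ _} tt)

-- Nine levels and four rounds suffice: `certified₅` confirms that the ninth level has no
-- continuation and that the levels are closed under bumping.
levels₅ : List (WordSet 5)
levels₅ = levels 5 5 9 4

certified₅ : certifies 5 levels₅ ≡ true
certified₅ = refl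

bounds₅ : GapBounds 5 5
bounds₅ =
  (length levels₅ , λ ps → tiling-many-monos 5 levels₅ certified₅ {ps = ps}) ,
  -- The last `refl` checks that two monominoes on 10 columns amount to one per 5.
  tiling-few-monos periodic₅ 5 (s≤s (s≤s z≤n)) refl

periodic₇ : PeriodicBlock 7 14 overhang₇ block₇
periodic₇ = periodicBlock (toWitness {a? = sameCounts? _ _} tt) (toWitness {a? = sameCounts? _ _} tt)

levels₇ : List (WordSet 7)
levels₇ = levels 7 7 11 3

certified₇ : certifies 7 levels₇ ≡ true
certified₇ = refl

bounds₇ : GapBounds 7 7
bounds₇ =
  (length levels₇ , λ ps → tiling-many-monos 7 levels₇ certified₇ {ps = ps}) ,
  tiling-few-monos periodic₇ 7 (s≤s (s≤s z≤n)) refl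

periodic₁₁ : PeriodicBlock 11 35 overhang₁₁ block₁₁
periodic₁₁ = periodicBlock (toWitness {a? = sameCounts? _ _} tt) (toWitness {a? = sameCounts? _ _} tt)

levels₁₁ : List (WordSet 11)
levels₁₁ = levels 11 35 45 1

certified₁₁ : certifies 35 levels₁₁ ≡ true
certified₁₁ = refl

bounds₁₁ : GapBounds 11 35
bounds₁₁ =
  (length levels₁₁ , λ ps → tiling-many-monos 35 levels₁₁ certified₁₁ {ps = ps}) ,
  tiling-few-monos periodic₁₁ 35 (s≤s (s≤s z≤n)) refl

theorem3 : Σ[ e₅ ∈ (ℕ → ℤ) ] Σ[ e₇ ∈ (ℕ → ℤ) ] Σ[ e₁₁ ∈ (ℕ → ℤ) ]
    (BoundedPos e₅ × BoundedPos e₇ × BoundedPos e₁₁ ×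
    (∀ n → 1 ≤ n →
    GapFormula 5 5 e₅ n × GapFormula 7 7 e₇ n × GapFormula 11 35 e₁₁ n))
theorem3 =
  let e₅ , bounded₅ , formula₅ = gapFormula 5 5 bounds₅
      e₇ , bounded₇ , formula₇ = gapFormula 7 7 bounds₇
      e₁₁ , bounded₁₁ , formula₁₁ = gapFormula 11 35 bounds₁₁
  in e₅ , e₇ , e₁₁ , bounded₅ , bounded₇ , bounded₁₁ ,
     λ n _ → formula₅ n , formula₇ n , formula₁₁ n
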